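{- For all integers $t,n\ge 2$ we have $R_{cr}(t,n)=2t(n-1)+1$.
   Context: The ordered complete graph on $[m]=\{1,\dots,m\}$ is the complete graph with vertex set $[m]$, taken with its natural ordering; edges are written $(i,j)$ with $i<j$. Two edges are independent if they share no vertex; independent edges $(a,b)$ and $(c,d)$ are crossing if $a<c<b<d$ or $c<a<d<b$. A matching is a set of pairwise independent edges; it is crossing if any two of its edges are crossing, and monochromatic if all its edges have the same color. $R_{cr}(t,n)$ denotes the smallest $m$ such that in every coloring of the edges of the ordered complete graph on $[m]$ with $t$ colors there is a monochromatic crossing matching with $n$ edges. -}

module Defs where

open import Data.Nat using (ℕ) renaming (_≤_ to _≤ᴺ_)
open import Data.Fin using (Fin; _<_)
open import Data.List using (List; length)
open import Data.List.Relation.Unary.All using (All)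
open import Data.List.Relation.Unary.AllPairs using (AllPairs)
open import Data.Product using (_×_; ∃-syntax)
open import Data.Sum using (_⊎_)
open import Relation.Binary.PropositionalEquality using (_≡_; _≢_)

-- The vertex set [m] is modelled by Fin m with its usual order.
record Edge (m : ℕ) : Set where
  constructor edge
  field
    left    : Fin m
    right   : Fin m
    ordered : left < right

open Edge public

-- Since `ordered` is a proof-irrelevant proposition, a function on Edge m
-- depends only on the two end points.  Colourings need not use every colour.
Colouring : ℕ → ℕ → Set
Colouring t m = Edge m → Fin t

Independent : ∀ {m} → Edge m → Edge m → Set
Independent e f =
  left e ≢ left f × left e ≢ right f × right e ≢ left f × right e ≢ right f

-- The strict inequalities already force e and f to be independent.
Crossing : ∀ {m} → Edge m → Edge m → Set
Crossing e f =
    (left e < left f × left f < right e × right e < right f)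
  ⊎ (left f < left e × left e < right f × right f < right e)

-- A finite set of edges is given by a list; there are no repetitions because
-- no edge is independent of itself, so the number of edges is the length.
IsMatching : ∀ {m} → List (Edge m) → Set
IsMatching M = AllPairs Independent M

IsCrossing : ∀ {m} → List (Edge m) → Set
IsCrossing M = AllPairs Crossing M

IsMonochromatic : ∀ {t m} → Colouring t m → List (Edge m) → Set
IsMonochromatic χ M = ∃[ k ] All (λ e → χ e ≡ k) M

HasMonochromaticCrossingMatching : ∀ {t m} → ℕ → Colouring t m → Set
HasMonochromaticCrossingMatching n χ =
  ∃[ M ] (IsMatching M × IsCrossing M × IsMonochromatic χ M × length M ≡ n)

Forces : ℕ → ℕ → ℕ → Set
Forces t n m = (χ : Colouring t m) → HasMonochromaticCrossingMatching n χ

IsLeast : (ℕ → Set) → ℕ → Set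
IsLeast P m = P m × (∀ k → P k → m ≤ᴺ k)

-- R_cr(t,n) = m, as a relation since R_cr is defined as a least element.
IsR-cr : ℕ → ℕ → ℕ → Set
IsR-cr t n m = IsLeast (Forces t n) m

{-# OPTIONS --safe #-}

-- Upper bound.  With N = t(n-1), the 2N+1 longest diagonals of a convex (2N+1)-gon
-- form a cycle in which any two non-consecutive diagonals cross.  If the cycle is
-- monochromatic, take every other diagonal.  Otherwise cut it between two consecutive
-- diagonals of different colours; some colour occurs at least 2(n-1)+1 times on the
-- resulting path, and every other diagonal of that colour belongs to a crossing matching,
-- because the two ends of the path, the only pair made adjacent by closing it up, have
-- different colours.
--
-- Lower bound.  Among at most 2N vertices, crossing edges (a,b) have values of
-- ⌊(a+b)/2⌋ that are distinct modulo N.  Cutting the N residues into t blocks of n-1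
-- and colouring each edge by its block leaves at most n-1 pairwise crossing edges
-- of each colour.
module Submission where

open import Data.Fin as Fin using (Fin; toℕ; fromℕ<; combine; quotient; remainder)
open import Data.Fin.Properties
  using (toℕ<n; toℕ-fromℕ<; toℕ-injective; combine-remQuot; pigeonhole)
import Data.Fin.Properties as Fin using (<⇒≢)
open import Data.List using (List; []; _∷_; length; map; filter; take; lookup; applyUpTo; allFin)
open import Data.List.Properties using (length-map; length-take; length-applyUpTo; length-tabulate)
open import Data.List.Membership.Propositional using (_∈_)
open import Data.List.Membership.Propositional.Properties using (∈-lookup; ∈-allFin)
import Data.List.Relation.Binary.Sublist.Propositional.Properties as Sublist
open import Data.List.Relation.Unary.All as All using (All; []; _∷_)
import Data.List.Relation.Unary.All.Properties as All
open import Data.List.Relation.Unary.AllPairs as AllPairs using (AllPairs; []; _∷_)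
import Data.List.Relation.Unary.AllPairs.Properties as AllPairs
open import Data.List.Relation.Unary.Any using (here; there)
open import Data.Nat
  using (ℕ; zero; suc; _+_; _*_; _∸_; _≤_; _<_; s≤s; s≤s⁻¹; ⌊_/2⌋; ⌈_/2⌉; NonZero;
         >-nonZero; >-nonZero⁻¹)
open import Data.Nat.DivMod
  using (_%_; _mod_; m%n<n; m<n⇒m%n≡m; [m+n]%n≡m%n; %-distribˡ-+)
open import Data.Nat.Properties
open import Data.Product using (_×_; _,_; ∃-syntax)
open import Data.Sum using (_⊎_; inj₁; inj₂; swap)
open import Function using (_∘_)
open import Relation.Binary using (DecidableEquality; Rel)
open import Relation.Binary.PropositionalEquality
  using (_≡_; _≢_; refl; sym; trans; cong; cong₂; subst; subst₂; ≢-sym)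
open import Relation.Nullary using (¬_; yes; no; contradiction)
open import Relation.Nullary.Decidable using (¬?; decidable-stable)
open import Relation.Unary using (Pred; Decidable)
open import Defs

-- Arithmetic

⌊m+[n+n]/2⌋≡⌊m/2⌋+n : ∀ m n → ⌊ m + (n + n) /2⌋ ≡ ⌊ m /2⌋ + n
⌊m+[n+n]/2⌋≡⌊m/2⌋+n zero          n = sym (n≡⌊n+n/2⌋ n)
⌊m+[n+n]/2⌋≡⌊m/2⌋+n (suc zero)    n = sym (n≡⌈n+n/2⌉ n)
⌊m+[n+n]/2⌋≡⌊m/2⌋+n (suc (suc m)) n = cong suc (⌊m+[n+n]/2⌋≡⌊m/2⌋+n m n)

-- Since `m % n + d < 2n`, reduction subtracts `n` at most once. The second case is written
-- additively to avoid truncated subtraction.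
%-step : ∀ m {d} n .{{_ : NonZero n}} → d < n →
         (m + d) % n ≡ m % n + d ⊎ (m + d) % n + n ≡ m % n + d
%-step m {d} n d<n = step (m % n + d <? n)
  where
  reduce : (m + d) % n ≡ (m % n + d) % n
  reduce = trans (%-distribˡ-+ m d n) (cong (λ x → (m % n + x) % n) (m<n⇒m%n≡m d<n))

  step : _ → _
  step (yes small) = inj₁ (trans reduce (m<n⇒m%n≡m small))
  step (no  large) = inj₂ (trans (cong (_+ n) wrapped) y+n≡)
    where
    y = m % n + d ∸ n

    y+n≡ : y + n ≡ m % n + d
    y+n≡ = m∸n+n≡m (≮⇒≥ large)

    y<n : y < n
    y<n = +-cancelʳ-< n y n (subst (_< n + n) (sym y+n≡) (+-mono-< (m%n<n m n) d<n))

    wrapped : (m + d) % n ≡ y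
    wrapped = trans reduce (trans (cong (_% n) (sym y+n≡))
                (trans ([m+n]%n≡m%n y n) (m<n⇒m%n≡m y<n)))

m<o<m+n⇒m%n≢o%n : ∀ {m o} n .{{_ : NonZero n}} → m < o → o < m + n → m % n ≢ o % n
m<o<m+n⇒m%n≢o%n {m} n m<o o<m+n eq with m≤n⇒∃[o]m+o≡n (<⇒≤ m<o)
... | d , refl with d<n ← +-cancelˡ-< m d n o<m+n | %-step m n d<n
...   | inj₁ same = <-irrefl (trans (sym (+-identityʳ m)) (cong (m +_) (sym d≡0))) m<o
  where
  d≡0 : d ≡ 0
  d≡0 = +-cancelˡ-≡ (m % n) d 0 (trans (sym same) (trans (sym eq) (sym (+-identityʳ _))))
...   | inj₂ wrap = <-irrefl (+-cancelˡ-≡ (m % n) d n (trans (sym wrap) (cong (_+ n) (sym eq)))) d<n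

-- Lists

module _ {a ℓ} {A : Set a} {R : Rel A ℓ} where

  AllPairs-lookup : ∀ {xs} → AllPairs R xs → ∀ {i j} → i Fin.< j → R (lookup xs i) (lookup xs j)
  AllPairs-lookup (x~xs ∷ _) {Fin.zero}  {Fin.suc j} _         = All.lookup x~xs (∈-lookup j)
  AllPairs-lookup (_ ∷ xs~)  {Fin.suc i} {Fin.suc j} (s≤s i<j) = AllPairs-lookup xs~ i<j

  AllPairs-within : ∀ {p s} {P : Pred A p} {S : Rel A s} →
                    (∀ {x y} → P x → P y → R x y → S x y) →
                    ∀ {xs} → All P xs → AllPairs R xs → AllPairs S xs
  AllPairs-within f []         []           = []
  AllPairs-within f (px ∷ pxs) (x~xs ∷ xs~) =
    All.zipWith (λ (py , r) → f px py r) (pxs , x~xs) ∷ AllPairs-within f pxs xs~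

module _ {a} {A : Set a} where

  alternate : List A → List A
  alternate []           = []
  alternate (x ∷ [])     = x ∷ []
  alternate (x ∷ _ ∷ xs) = x ∷ alternate xs

  length-alternate : ∀ xs → length (alternate xs) ≡ ⌈ length xs /2⌉
  length-alternate []           = refl
  length-alternate (_ ∷ [])     = refl
  length-alternate (_ ∷ _ ∷ xs) = cong suc (length-alternate xs)

  All-alternate : ∀ {p} {P : Pred A p} {xs} → All P xs → All P (alternate xs)
  All-alternate []             = []
  All-alternate (px ∷ [])      = px ∷ []
  All-alternate (px ∷ _ ∷ pxs) = px ∷ All-alternate pxs

  -- Here `y` is an entry skipped between the kept entries `x` and `z`; for increasing indices it
  -- supplies a gap of at least 2.
  AllPairs-alternate : ∀ {r s} {R : Rel A r} {S : Rel A s} →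
                       (∀ {x y z} → R x y → R y z → R x z → S x z) →
                       ∀ {xs} → AllPairs R xs → AllPairs S (alternate xs)
  AllPairs-alternate f []       = []
  AllPairs-alternate f ([] ∷ _) = [] ∷ []
  AllPairs-alternate f ((x~y ∷ x~xs) ∷ y~xs ∷ xs~) =
    All-alternate (All.zipWith (λ (y~z , x~z) → f x~y y~z x~z) (y~xs , x~xs))
    ∷ AllPairs-alternate f xs~

  length-filter-¬ : ∀ {p} {P : Pred A p} (P? : Decidable P) xs →
                    length xs ≡ length (filter P? xs) + length (filter (¬? ∘ P?) xs)
  length-filter-¬ P? [] = refl
  length-filter-¬ P? (x ∷ xs) with P? x
  ... | yes _ = cong suc (length-filter-¬ P? xs)
  ... | no  _ = trans (cong suc (length-filter-¬ P? xs)) (sym (+-suc _ _))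

module _ {a b} {A : Set a} {B : Set b} (_≟_ : DecidableEquality B) (c : A → B) where

  fibre : B → List A → List A
  fibre k = filter (λ x → c x ≟ k)

  generalised-pigeonhole : ∀ q ks xs → All (λ x → c x ∈ ks) xs →
                           length ks * q < length xs → ∃[ k ] q < length (fibre k xs)
  generalised-pigeonhole q [] (_ ∷ _) (() ∷ _) _
  generalised-pigeonhole q (k ∷ ks) xs c∈ many with q <? length (fibre k xs)
  ... | yes q< = k , q<
  ... | no  q≮ =
    -- At most `q` entries have colour `k`, so more than `length ks * q` are left for the other
    -- colours.
    let l , q< = generalised-pigeonhole q ks rest rest∈ rest-many
    in  l , <-≤-trans q< (Sublist.length-mono-≤
              (Sublist.filter⁺ _ _ (λ { refl e → e }) (Sublist.filter-⊆ _ xs)))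
    where
    rest = filter (λ x → ¬? (c x ≟ k)) xs

    rest∈ : All (λ x → c x ∈ ks) rest
    rest∈ = All.zipWith
      (λ { (here e , ¬e) → contradiction e ¬e ; (there m , _) → m })
      (All.filter⁺ _ c∈ , All.all-filter _ xs)

    rest-many : length ks * q < length rest
    rest-many = +-cancelˡ-< q _ _ (<-≤-trans many (≤-trans
      (≤-reflexive (length-filter-¬ (λ x → c x ≟ k) xs))
      (+-monoˡ-≤ _ (≮⇒≥ q≮))))

-- Crossing edges

Crossing⇒Independent : ∀ {m} {e f : Edge m} → Crossing e f → Independent e f
Crossing⇒Independent (inj₁ (a<c , c<b , b<d)) =
  Fin.<⇒≢ a<c , Fin.<⇒≢ (<-trans a<c (<-trans c<b b<d)) , ≢-sym (Fin.<⇒≢ c<b) , Fin.<⇒≢ b<d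
Crossing⇒Independent (inj₂ (c<a , a<d , d<b)) =
  ≢-sym (Fin.<⇒≢ c<a) , Fin.<⇒≢ a<d , ≢-sym (Fin.<⇒≢ (<-trans c<a (<-trans a<d d<b))) , ≢-sym (Fin.<⇒≢ d<b)

-- Upper bound

module Diagonals (N : ℕ) .{{_ : NonZero N}} where

  size : ℕ
  size = suc (N + N)

  -- Consecutive diagonals share a vertex, and so do the last one (N,2N) and the first one (0,N).
  diagonal : Fin size → Edge size
  diagonal j = edge (fromℕ< l<) (fromℕ< r<)
    (subst₂ _<_ (sym (toℕ-fromℕ< l<)) (sym (toℕ-fromℕ< r<)) l<r)
    where
    l<r : ⌊ toℕ j /2⌋ < ⌈ toℕ j /2⌉ + N
    l<r = ≤-<-trans (⌊n/2⌋≤⌈n/2⌉ (toℕ j)) (m<m+n _ (>-nonZero⁻¹ N))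

    r< : ⌈ toℕ j /2⌉ + N < size
    r< = s≤s (+-monoˡ-≤ N (≤-trans (⌈n/2⌉-mono (s≤s⁻¹ (toℕ<n j))) (≤-reflexive (sym (n≡⌈n+n/2⌉ N)))))

    l< : ⌊ toℕ j /2⌋ < size
    l< = <-trans l<r r<

  -- A gap of 2 moves both end points strictly to the right. The upper bound on `k` excludes only
  -- the pair `0`, `2N`, whose diagonals share the vertex `N`.
  diagonal-crossing : ∀ j k → 2 + toℕ j ≤ toℕ k → toℕ k < toℕ j + (N + N) →
                      Crossing (diagonal j) (diagonal k)
  diagonal-crossing j k 2+j≤k k<j+2N = inj₁
    ( subst₂ _<_ (sym (toℕ-fromℕ< _)) (sym (toℕ-fromℕ< _)) (⌊n/2⌋-mono 2+j≤k)
    , subst₂ _<_ (sym (toℕ-fromℕ< _)) (sym (toℕ-fromℕ< _))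
        -- Halve `k + 2 ≤ (j + 1) + 2N`; the half of `j + 1` rounded down is `⌈ j /2⌉`.
        (≤-trans (⌊n/2⌋-mono (s≤s k<j+2N)) (≤-reflexive (⌊m+[n+n]/2⌋≡⌊m/2⌋+n (suc (toℕ j)) N)))
    , subst₂ _<_ (sym (toℕ-fromℕ< _)) (sym (toℕ-fromℕ< _)) (+-monoˡ-< N (⌈n/2⌉-mono 2+j≤k)))

  -- Indexing by all of `ℕ` lets a path start anywhere on the cycle and still have increasing
  -- indices.
  cyclic : ℕ → Edge size
  cyclic i = diagonal (i mod size)

  cyclic-periodic : ∀ i → cyclic (i + size) ≡ cyclic i
  cyclic-periodic i = cong diagonal (toℕ-injective
    (trans (toℕ-fromℕ< _) (trans ([m+n]%n≡m%n i size) (sym (toℕ-fromℕ< _)))))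

  cyclic-crossing : ∀ {i k} → 2 + i ≤ k → k < i + (N + N) → Crossing (cyclic i) (cyclic k)
  cyclic-crossing {i} 2+i≤k k<i+2N with m≤n⇒∃[o]m+o≡n (≤-trans (m≤n+m i 2) 2+i≤k)
  ... | d , refl = cross (%-step i size (<-trans d<2N (n<1+n _)))
    where
    r = i % size
    s = (i + d) % size

    d<2N : d < N + N
    d<2N = +-cancelˡ-< i d (N + N) k<i+2N

    2≤d : 2 ≤ d
    2≤d = +-cancelˡ-≤ i 2 d (subst (_≤ i + d) (+-comm 2 i) 2+i≤k)

    toℕ-r : toℕ (i mod size) ≡ r
    toℕ-r = toℕ-fromℕ< _

    toℕ-s : toℕ ((i + d) mod size) ≡ s
    toℕ-s = toℕ-fromℕ< _

    2+r≤r+d : 2 + r ≤ r + d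
    2+r≤r+d = subst (_≤ r + d) (+-comm r 2) (+-monoʳ-≤ r 2≤d)

    cross : s ≡ r + d ⊎ s + size ≡ r + d → Crossing (cyclic i) (cyclic (i + d))
    cross (inj₁ s≡) = diagonal-crossing _ _
      (subst₂ (λ x y → 2 + x ≤ y) (sym toℕ-r) (sym (trans toℕ-s s≡)) 2+r≤r+d)
      (subst₂ (λ x y → y < x + (N + N)) (sym toℕ-r) (sym (trans toℕ-s s≡)) (+-monoʳ-< r d<2N))
    -- After wrapping, `s` precedes `r` by `size - d`, so the bounds exchange roles: `d < 2N` makes
    -- this gap at least 2, and `2 ≤ d` keeps it below `2N`.
    cross (inj₂ s+size≡) = swap (diagonal-crossing _ _
      (subst₂ (λ x y → 2 + x ≤ y) (sym toℕ-s) (sym toℕ-r)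
        (+-cancelʳ-< (N + N) (suc s) r (subst (_< r + (N + N)) 1+s+2N≡ (+-monoʳ-< r d<2N))))
      (subst₂ (λ x y → y < x + (N + N)) (sym toℕ-s) (sym toℕ-r)
        (s≤s⁻¹ (subst (2 + r ≤_) 1+s+2N≡ 2+r≤r+d))))
      where
      1+s+2N≡ : r + d ≡ suc s + (N + N)
      1+s+2N≡ = trans (sym s+size≡) (+-suc s (N + N))

  module _ {t : ℕ} (χ : Colouring t size) where

    spread⇒matching : ∀ n κ is → AllPairs (λ i k → i < k × k < i + (N + N)) is →
                      All (λ i → χ (cyclic i) ≡ κ) is → n ≤ ⌈ length is /2⌉ →
                      HasMonochromaticCrossingMatching n χ
    spread⇒matching n κ is spread colour n≤ =
        map cyclic js
      , AllPairs.map (λ {e} {f} → Crossing⇒Independent {e = e} {f}) crossing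
      , crossing
      , (κ , All.map⁺ (All.take⁺ n (All-alternate colour)))
      , trans (length-map cyclic js) (trans (length-take n (alternate is))
          (m≤n⇒m⊓n≡m (≤-trans n≤ (≤-reflexive (sym (length-alternate is))))))
      where
      -- The selection may be too long; it is trimmed to exactly `n` indices.
      js = take n (alternate is)

      crossing : AllPairs Crossing (map cyclic js)
      crossing = AllPairs.map⁺ (AllPairs.take⁺ n (AllPairs-alternate
        (λ (x<y , _) (y<z , _) (_ , z<) → cyclic-crossing (<-≤-trans (s≤s x<y) y<z) z<)
        spread))

    constant⇒matching : ∀ n → n ≤ N →
                        (∀ {j} → j < N + N → χ (cyclic j) ≡ χ (cyclic (suc j))) →
                        HasMonochromaticCrossingMatching n χ
    -- Index `2N` is left out because it neighbours `0` on the cycle; every other one of the first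
    -- `2N` indices still gives `N` edges.
    constant⇒matching n n≤N same = spread⇒matching n (χ (cyclic 0)) (applyUpTo (λ i → i) (N + N))
      (AllPairs.applyUpTo⁺₁ _ (N + N) (λ {i} i<k k<2N → i<k , <-≤-trans k<2N (m≤n+m (N + N) i)))
      (All.applyUpTo⁺₁ _ (N + N) same-as-0)
      (≤-trans n≤N (≤-trans (≤-reflexive (n≡⌈n+n/2⌉ N))
        (≤-reflexive (cong ⌈_/2⌉ (sym (length-applyUpTo (λ i → i) (N + N)))))))
      where
      same-as-0 : ∀ {i} → i < N + N → χ (cyclic i) ≡ χ (cyclic 0)
      same-as-0 {zero}  _    = refl
      same-as-0 {suc i} i<2N = trans (sym (same (<⇒≤ i<2N))) (same-as-0 (<⇒≤ i<2N))

    cut⇒matching : ∀ p → t * p ≡ N → ∀ j → χ (cyclic j) ≢ χ (cyclic (suc j)) →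
                   HasMonochromaticCrossingMatching (suc p) χ
    cut⇒matching p tp≡N j differ =
      let κ , many = generalised-pigeonhole Fin._≟_ (χ ∘ cyclic) (p + p) (allFin t) path
                       (All.universal (λ _ → ∈-allFin _) path) path-long
          coloured = All.all-filter (λ i → χ (cyclic i) Fin.≟ κ) path
      in  spread⇒matching (suc p) κ (fibre Fin._≟_ (χ ∘ cyclic) κ path)
            -- Inside one colour class the colour condition of `path-spread` holds, so its distance
            -- bound becomes unconditional.
            (AllPairs-within (λ ci ck (i<k , near) → i<k , near (trans ci (sym ck)))
              coloured (AllPairs.filter⁺ (λ i → χ (cyclic i) Fin.≟ κ) path-spread))
            coloured
            -- At least `2p + 1` indices share the colour, and half of `2p + 1` rounded up is
            -- `p + 1`.
            (≤-trans (≤-reflexive (cong suc (n≡⌊n+n/2⌋ p))) (⌈n/2⌉-mono many))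
      where
      -- One full turn starting just after the colour change; its last index `j + size` denotes the
      -- same diagonal as `j`.
      path = applyUpTo (suc j +_) size

      path-long : length (allFin t) * (p + p) < length path
      path-long = ≤-reflexive (trans
        (cong suc (trans (cong (_* (p + p)) (length-tabulate {n = t} (λ i → i)))
          (trans (*-distribˡ-+ t p p) (cong₂ _+_ tp≡N tp≡N))))
        (sym (length-applyUpTo (suc j +_) size)))

      ends-differ : χ (cyclic (suc j)) ≢ χ (cyclic (suc j + (N + N)))
      ends-differ eq = differ (sym (trans eq (cong χ
        (trans (cong cyclic (sym (+-suc j (N + N)))) (cyclic-periodic j)))))

      near : ∀ {i k} → k < size → χ (cyclic (suc j + i)) ≡ χ (cyclic (suc j + k)) →
             k < i + (N + N)
      near {suc i} k<        _  = ≤-trans k< (s≤s (m≤n+m (N + N) i))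
      -- With `i = 0` the bound fails only at `k = 2N`, but these are the two ends of the path,
      -- whose colours differ.
      near {zero}  (s≤s k≤) eq = ≤∧≢⇒< k≤ λ { refl → ends-differ
        (trans (cong (χ ∘ cyclic) (sym (+-identityʳ (suc j)))) eq) }

      path-spread : AllPairs (λ i k → i < k × (χ (cyclic i) ≡ χ (cyclic k) → k < i + (N + N))) path
      path-spread = AllPairs.applyUpTo⁺₁ _ size λ {i} {k} i<k k< →
        +-monoʳ-< (suc j) i<k ,
        λ eq → subst (suc j + k <_) (sym (+-assoc (suc j) i (N + N)))
                 (+-monoʳ-< (suc j) (near k< eq))

forces : ∀ t p → 2 ≤ t → 1 ≤ p → Forces t (suc p) (suc (t * p + t * p))
forces t p 2≤t 1≤p χ = from-cut
  (anyUpTo? (λ j → ¬? (χ (cyclic j) Fin.≟ χ (cyclic (suc j)))) (t * p + t * p))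
  where
  instance
    tp≢0 : NonZero (t * p)
    tp≢0 = >-nonZero (*-mono-≤ (<⇒≤ 2≤t) 1≤p)
  open Diagonals (t * p)

  -- The constant case asks for `n ≤ N`: here `1 + p ≤ 2p ≤ tp`, from `1 ≤ p` and `2 ≤ t`.
  1+p≤tp : suc p ≤ t * p
  1+p≤tp = ≤-trans (+-mono-≤ 1≤p (≤-reflexive (sym (+-identityʳ p)))) (*-monoˡ-≤ p 2≤t)

  from-cut : _ → _
  from-cut (yes (j , _ , differ)) = cut⇒matching χ p refl j differ
  from-cut (no  never)            = constant⇒matching χ (suc p) 1+p≤tp
    (λ {j} j< → decidable-stable (_ Fin.≟ _) (λ differ → never (j , j< , differ)))

-- Lower bound

module BlockColouring (t p m : ℕ) .{{_ : NonZero (t * p)}} (m≤2tp : m ≤ t * p + t * p) where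

  -- In a convex `2N`-gon, chords with equal end point sum modulo `2N` are parallel; halving merges
  -- two neighbouring directions into one class.
  halfSum : Edge m → ℕ
  halfSum e = ⌊ toℕ (left e) + toℕ (right e) /2⌋

  residue : Edge m → Fin (t * p)
  residue e = halfSum e mod (t * p)

  colouring : Colouring t m
  colouring e = quotient p (residue e)

  -- Write `N` for `t * p`. Interleaving gives `a + b + 2 ≤ c + d`, and with `d < 2N` also
  -- `c + d + 2 ≤ a + b + 2N`. After halving, the values differ by at least 1 and by less than `N`.
  halfSum-interleaved : ∀ e f → left e Fin.< left f → left f Fin.< right e → right e Fin.< right f →
                        halfSum e % (t * p) ≢ halfSum f % (t * p)
  halfSum-interleaved e f a<c c<b b<d = m<o<m+n⇒m%n≢o%n (t * p)
    (⌊n/2⌋-mono (subst (_≤ c + d) (cong suc (+-suc a b)) (+-mono-≤ a<c b<d)))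
    (subst (halfSum f <_) (⌊m+[n+n]/2⌋≡⌊m/2⌋+n (a + b) (t * p)) (⌊n/2⌋-mono
      (≤-trans (subst (_≤ b + (t * p + t * p)) (cong suc (+-suc c d))
                 (+-mono-≤ c<b (≤-trans (toℕ<n (right f)) m≤2tp)))
               (+-monoˡ-≤ _ (m≤n+m b a)))))
    where
    a = toℕ (left e)
    b = toℕ (right e)
    c = toℕ (left f)
    d = toℕ (right f)

  Crossing⇒residue≢ : ∀ {e f} → Crossing e f → residue e ≢ residue f
  Crossing⇒residue≢ {e} {f} crossing eq = distinct crossing
    (trans (sym (toℕ-fromℕ< _)) (trans (cong toℕ eq) (toℕ-fromℕ< _)))
    where
    distinct : Crossing e f → halfSum e % (t * p) ≢ halfSum f % (t * p)
    distinct (inj₁ (a<c , c<b , b<d)) = halfSum-interleaved e f a<c c<b b<d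
    distinct (inj₂ (c<a , a<d , d<b)) = ≢-sym (halfSum-interleaved f e c<a a<d d<b)

  residue-determined : ∀ {e f} → colouring e ≡ colouring f →
                       remainder {t} p (residue e) ≡ remainder {t} p (residue f) →
                       residue e ≡ residue f
  residue-determined {e} {f} q≡ r≡ = trans (sym (combine-remQuot {t} p (residue e)))
    (trans (cong₂ combine q≡ r≡) (combine-remQuot {t} p (residue f)))

  no-matching : ¬ HasMonochromaticCrossingMatching (suc p) colouring
  no-matching (M , _ , crossing , (κ , coloured) , length≡) =
    -- The `p + 1` edges have only `p` positions available within the block `κ`, so two of them
    -- agree in block and position, hence in residue.
    let i , j , i<j , r≡ = pigeonhole (≤-reflexive (sym length≡))
                             (remainder {t} p ∘ residue ∘ lookup M)
        colour-of i = All.lookup coloured (∈-lookup i)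
    in  Crossing⇒residue≢ {lookup M i} {lookup M j} (AllPairs-lookup crossing i<j)
          (residue-determined {lookup M i} {lookup M j} (trans (colour-of i) (sym (colour-of j))) r≡)

-- The block colouring exists for every `m ≤ 2tp`, so minimality follows without comparing different
-- values of `m`.
forces⇒> : ∀ t p m .{{_ : NonZero (t * p)}} → Forces t (suc p) m → t * p + t * p < m
forces⇒> t p m forced = ≰⇒> λ m≤2tp →
  BlockColouring.no-matching t p m m≤2tp (forced (BlockColouring.colouring t p m m≤2tp))

theorem2p18 : (t n : ℕ) → 2 ≤ t → 2 ≤ n → IsR-cr t n (2 * t * (n ∸ 1) + 1)
theorem2p18 t (suc p) 2≤t (s≤s 1≤p) = subst (IsR-cr t (suc p)) (sym size≡)
  (forces t p 2≤t 1≤p , λ m → forces⇒> t p m {{>-nonZero (*-mono-≤ (<⇒≤ 2≤t) 1≤p)}})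
  where
  size≡ : 2 * t * p + 1 ≡ suc (t * p + t * p)
  size≡ = trans (+-comm _ 1)
    (cong suc (trans (*-assoc 2 t p) (cong (t * p +_) (+-identityʳ (t * p)))))
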